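{- There exists a residuated lattice $A$ that satisfies $\neg a\vee\neg\neg a=1$ for all $a\in A$ and that is not co-Stone.
   Context: A residuated lattice is an algebra $(A,\vee,\wedge,\odot,\rightarrow,0,1)$ such that $(A,\vee,\wedge,0,1)$ is a bounded lattice, $(A,\odot,1)$ is a commutative monoid, and $a\leq b\rightarrow c$ iff $a\odot b\leq c$ for all $a,b,c\in A$. $\neg a=a\rightarrow 0$. A filter of $A$ is a non-empty upward closed subset closed under $\odot$; $\langle x\rangle$ is the filter generated by $x$. $B(A)$ is the set of complemented elements of the bounded lattice $A$, and $x^{\top}=\{a\in A\mid a\vee x=1\}$. $A$ is co-Stone iff for all $x\in A$ there exists $e\in B(A)$ with $x^{\top}=\langle e\rangle$. -}

module Defs where

open import Level using (suc)
open import Algebra.Core using (Op₁; Op₂)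
open import Algebra.Structures using (IsCommutativeMonoid)
open import Data.Product using (_×_; ∃-syntax)
open import Function.Bundles using (_⇔_)
open import Relation.Binary.Core using (Rel)
open import Relation.Binary.Lattice.Structures using (IsBoundedLattice)
open import Relation.Binary.PropositionalEquality using (_≡_)
open import Relation.Unary using (Pred; _∈_; _≐_; Satisfiable)

record ResiduatedLattice c : Set (suc c) where
  infixr 5 _⇒_
  infixr 6 _∨_
  infixr 7 _∧_ _⊙_
  infix  4 _≤_
  field
    Carrier : Set c
    _∨_     : Op₂ Carrier
    _∧_     : Op₂ Carrier
    _⊙_     : Op₂ Carrier
    _⇒_     : Op₂ Carrier
    0#      : Carrier
    1#      : Carrier

  -- The order is not part of the signature: it is the one induced by the meet.
  _≤_ : Rel Carrier c
  a ≤ b = a ∧ b ≡ a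

  field
    isBoundedLattice      : IsBoundedLattice _≡_ _≤_ _∨_ _∧_ 1# 0#
    ⊙-isCommutativeMonoid : IsCommutativeMonoid _≡_ _⊙_ 1#
    residuation           : ∀ a b c → (a ≤ b ⇒ c) ⇔ (a ⊙ b ≤ c)

  infix 8 ∼_
  ∼_ : Op₁ Carrier
  ∼ a = a ⇒ 0#

  record IsFilter {ℓ} (F : Pred Carrier ℓ) : Set (c Level.⊔ ℓ) where
    field
      nonEmpty     : Satisfiable F
      upwardClosed : ∀ {a b} → a ∈ F → a ≤ b → b ∈ F
      ⊙-closed     : ∀ {a b} → a ∈ F → b ∈ F → a ⊙ b ∈ F

  -- The generated filter is the intersection of all filters containing x.
  -- Quantifying over subsets at level c raises the level of the result.
  ⟨_⟩ : Carrier → Pred Carrier (suc c)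
  ⟨ x ⟩ a = (F : Pred Carrier c) → IsFilter F → x ∈ F → a ∈ F

  B : Pred Carrier c
  B e = ∃[ f ] (e ∨ f ≡ 1# × e ∧ f ≡ 0#)

  _^⊤ : Carrier → Pred Carrier c
  (x ^⊤) a = a ∨ x ≡ 1#

  CoStone : Set (suc c)
  CoStone = ∀ x → ∃[ e ] (e ∈ B × (x ^⊤) ≐ ⟨ e ⟩)

{-# OPTIONS --safe #-}

-- Adjoin a new bottom element to the four-element Boolean algebra and take ⊙ = ∧.
-- Every old element is dense, so ∼ takes only the values 0 and 1, and the Stone
-- identity holds. The only complemented elements are 0 and 1, but for an atom x of the
-- Boolean algebra x ^⊤ contains the other atom and does not contain 0, so it is neither
-- ⟨ 1 ⟩ nor ⟨ 0 ⟩.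

module Submission where

open import Level using (0ℓ)
open import Algebra.Core using (Op₂)
open import Data.Bool as Bool using (Bool; true; false)
open import Data.Maybe using (Maybe; just; nothing)
import Data.Maybe.Properties as Maybe
open import Data.Product using (_×_; Σ-syntax; _,_; proj₁; proj₂)
import Data.Product.Properties as Product
open import Data.Sum using (_⊎_; inj₁; inj₂)
open import Function.Bundles using (mk⇔)
open import Relation.Nullary using (¬_; Dec; _×-dec_; _→-dec_; _⊎-dec_)
open import Relation.Nullary.Decidable using (map′; from-yes)
open import Relation.Unary using (Decidable)
open import Relation.Binary.Definitions using (DecidableEquality)
open import Relation.Binary.PropositionalEquality using (_≡_; refl; isEquivalence; cong₂)
open import Defs

Bool²⊥ : Set
Bool²⊥ = Maybe (Bool × Bool)

pattern 𝟎 = nothing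
pattern 𝟏 = just (true , true)

infixr 5 _⇒_
infixr 6 _⊔_
infixr 7 _⊓_
infix  4 _≤_ _≟_ _≤?_

_⊔_ _⊓_ _⇒_ : Op₂ Bool²⊥

𝟎            ⊔ y            = y
x@(just _)   ⊔ 𝟎            = x
just (p , q) ⊔ just (r , s) = just (p Bool.∨ r , q Bool.∨ s)

-- Old elements meet in an old element, so `𝟎` is a meet only when one of the factors is `𝟎`.
just (p , q) ⊓ just (r , s) = just (p Bool.∧ r , q Bool.∧ s)
_            ⊓ _            = 𝟎

-- Heyting implication. Between old elements it stays Boolean, because a new bottom does not change
-- the largest solution of `z ⊓ x ≤ y`.
𝟎            ⇒ _            = 𝟏
just _       ⇒ 𝟎            = 𝟎
just (p , q) ⇒ just (r , s) = just (Bool.not p Bool.∨ r , Bool.not q Bool.∨ s)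

_≤_ : Bool²⊥ → Bool²⊥ → Set
x ≤ y = x ⊓ y ≡ x

_≟_ : DecidableEquality Bool²⊥
_≟_ = Maybe.≡-dec (Product.≡-dec Bool._≟_ Bool._≟_)

_≤?_ : ∀ x y → Dec (x ≤ y)
x ≤? y = x ⊓ y ≟ x

-- With five elements, each law below is settled by exhaustive evaluation: `from-yes` type-checks
-- only if the decision computes to `yes`.
∀? : ∀ {P : Bool²⊥ → Set} → Decidable P → Dec (∀ x → P x)
∀? P? = map′
  (λ { (p , _) 𝟎                                  → p
     ; (_ , p , _) (just (false , false))         → p
     ; (_ , _ , p , _) (just (false , true))      → p
     ; (_ , _ , _ , p , _) (just (true , false))  → p
     ; (_ , _ , _ , _ , p) 𝟏                      → p })
  (λ p → p _ , p _ , p _ , p _ , p _)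
  (P? 𝟎 ×-dec P? (just (false , false)) ×-dec P? (just (false , true))
    ×-dec P? (just (true , false)) ×-dec P? 𝟏)

≤-refl : ∀ x → x ≤ x
≤-refl = from-yes (∀? λ x → x ≤? x)

≤-trans : ∀ x y z → x ≤ y → y ≤ z → x ≤ z
≤-trans = from-yes (∀? λ x → ∀? λ y → ∀? λ z →
  x ≤? y →-dec y ≤? z →-dec x ≤? z)

≤-antisym : ∀ x y → x ≤ y → y ≤ x → x ≡ y
≤-antisym = from-yes (∀? λ x → ∀? λ y → x ≤? y →-dec y ≤? x →-dec x ≟ y)

⊔-supremum : ∀ x y → x ≤ x ⊔ y × y ≤ x ⊔ y × (∀ z → x ≤ z → y ≤ z → x ⊔ y ≤ z)
⊔-supremum = from-yes (∀? λ x → ∀? λ y →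
  x ≤? x ⊔ y ×-dec y ≤? x ⊔ y ×-dec
  (∀? λ z → x ≤? z →-dec y ≤? z →-dec x ⊔ y ≤? z))

⊓-infimum : ∀ x y → x ⊓ y ≤ x × x ⊓ y ≤ y × (∀ z → z ≤ x → z ≤ y → z ≤ x ⊓ y)
⊓-infimum = from-yes (∀? λ x → ∀? λ y →
  x ⊓ y ≤? x ×-dec x ⊓ y ≤? y ×-dec
  (∀? λ z → z ≤? x →-dec z ≤? y →-dec z ≤? x ⊓ y))

𝟏-maximum : ∀ x → x ≤ 𝟏
𝟏-maximum = from-yes (∀? λ x → x ≤? 𝟏)

⊓-assoc : ∀ x y z → (x ⊓ y) ⊓ z ≡ x ⊓ (y ⊓ z)
⊓-assoc = from-yes (∀? λ x → ∀? λ y → ∀? λ z → (x ⊓ y) ⊓ z ≟ x ⊓ (y ⊓ z))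

⊓-comm : ∀ x y → x ⊓ y ≡ y ⊓ x
⊓-comm = from-yes (∀? λ x → ∀? λ y → x ⊓ y ≟ y ⊓ x)

⊓-identityˡ : ∀ x → 𝟏 ⊓ x ≡ x
⊓-identityˡ = from-yes (∀? λ x → 𝟏 ⊓ x ≟ x)

⇒-residual : ∀ x y z → (x ≤ y ⇒ z → x ⊓ y ≤ z) × (x ⊓ y ≤ z → x ≤ y ⇒ z)
⇒-residual = from-yes (∀? λ x → ∀? λ y → ∀? λ z →
  (x ≤? y ⇒ z →-dec x ⊓ y ≤? z) ×-dec (x ⊓ y ≤? z →-dec x ≤? y ⇒ z))

Bool²⊥-residuatedLattice : ResiduatedLattice 0ℓ
Bool²⊥-residuatedLattice = record
  { Carrier = Bool²⊥
  ; _∨_ = _⊔_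
  ; _∧_ = _⊓_
  ; _⊙_ = _⊓_
  ; _⇒_ = _⇒_
  ; 0# = 𝟎
  ; 1# = 𝟏
  ; isBoundedLattice = record
    { isLattice = record
      { isPartialOrder = record
        { isPreorder = record
          { isEquivalence = isEquivalence
          ; reflexive = λ { {x} refl → ≤-refl x }
          ; trans = ≤-trans _ _ _
          }
        ; antisym = ≤-antisym _ _
        }
      ; supremum = ⊔-supremum
      ; infimum = ⊓-infimum
      }
    ; maximum = 𝟏-maximum
    ; minimum = λ _ → refl
    }
  ; ⊙-isCommutativeMonoid = record
    { isMonoid = record
      { isSemigroup = record
        { isMagma = record { isEquivalence = isEquivalence ; ∙-cong = cong₂ _⊓_ }
        ; assoc = ⊓-assoc
        }
      -- Since the order is defined by the meet, `x ≤ 𝟏` is literally the right identity law.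
      ; identity = ⊓-identityˡ , 𝟏-maximum
      }
    ; comm = ⊓-comm
    }
  ; residuation = λ x y z → mk⇔ (proj₁ (⇒-residual x y z)) (proj₂ (⇒-residual x y z))
  }

module L = ResiduatedLattice Bool²⊥-residuatedLattice

stone : ∀ x → L.∼ x ⊔ L.∼ L.∼ x ≡ 𝟏
stone = from-yes (∀? λ x → L.∼ x ⊔ L.∼ L.∼ x ≟ 𝟏)

-- As `x ⊓ y ≡ 𝟎`, one of the two is `𝟎`; then `x ⊔ y ≡ 𝟏` makes the other `𝟏`.
complemented⇒trivial : ∀ {x} → L.B x → x ≡ 𝟎 ⊎ x ≡ 𝟏
complemented⇒trivial {x} (y , x⊔y≡𝟏 , x⊓y≡𝟎) = decide x y x⊔y≡𝟏 x⊓y≡𝟎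
  where
  decide : ∀ x y → x ⊔ y ≡ 𝟏 → x ⊓ y ≡ 𝟎 → x ≡ 𝟎 ⊎ x ≡ 𝟏
  decide = from-yes (∀? λ x → ∀? λ y →
    x ⊔ y ≟ 𝟏 →-dec x ⊓ y ≟ 𝟎 →-dec (x ≟ 𝟎 ⊎-dec x ≟ 𝟏))

-- Bounds `⟨ 𝟏 ⟩` from above: an element of a generated filter lies in every filter containing the
-- generator, this one included.
｛𝟏｝-isFilter : L.IsFilter (_≡ 𝟏)
｛𝟏｝-isFilter = record
  { nonEmpty = 𝟏 , refl
  ; upwardClosed = λ { {b = y} refl 𝟏≤y → ≤-antisym y 𝟏 (𝟏-maximum y) 𝟏≤y }
  ; ⊙-closed = λ { refl refl → refl }
  }

¬coStone : ¬ L.CoStone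
¬coStone coStone with coStone (just (true , false))
... | e , e∈B , x⊤⊆⟨e⟩ , ⟨e⟩⊆x⊤ with complemented⇒trivial e∈B
-- `𝟎` belongs to `⟨ 𝟎 ⟩`, which would force `𝟎 ⊔ x ≡ 𝟏` for the atom `x`.
...   | inj₁ refl with () ← ⟨e⟩⊆x⊤ {𝟎} (λ _ _ 𝟎∈F → 𝟎∈F)
-- The two atoms join to `𝟏`, so the other atom would lie in `⟨ 𝟏 ⟩` and hence equal `𝟏`.
...   | inj₂ refl with () ← x⊤⊆⟨e⟩ {just (false , true)} refl (_≡ 𝟏) ｛𝟏｝-isFilter refl

mainTheorem6 : Σ[ A ∈ ResiduatedLattice 0ℓ ]
    (let open ResiduatedLattice A in
    (∀ a → ∼ a ∨ ∼ ∼ a ≡ 1#) × ¬ CoStone)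
mainTheorem6 = Bool²⊥-residuatedLattice , stone , ¬coStone
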